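{- Let $\mathcal{H}=(V,E)$ be a hypergraph with $\emptyset\notin E$. Then $\mathcal{H}$ is threshold if and only if its split-incidence graph is connected-domishold.
   Context: A hypergraph $\mathcal{H}=(V,E)$ consists of a finite set $V$ and a set $E$ of subsets of $V$ (hyperedges). It is threshold if there exist $w:V\to\mathbb{R}_{\ge0}$ and $t\in\mathbb{R}_{\ge0}$ such that for all $X\subseteq V$, $\sum_{x\in X}w(x)\le t$ iff $X$ contains no hyperedge. The split-incidence graph of $\mathcal{H}$ is the graph with vertex set $V\cup E$ in which $V$ is a clique, $E$ is an independent set, and $v\in V$ is adjacent to $e\in E$ iff $v\in e$. A connected dominating set of a connected graph $G$ is a set $S\subseteq V(G)$ such that every vertex not in $S$ has a neighbor in $S$ and $G[S]$ is connected; $G$ is connected-domishold if there exist $w:V(G)\to\mathbb{R}_{\ge0}$, $t\in\mathbb{R}_{\ge0}$ such that for all $S\subseteq V(G)$, $\sum_{x\in S}w(x)\ge t$ iff $S$ is a connected dominating set. -}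

module Defs where

open import Algebra.Bundles using (RawMonoid)
import Algebra.Definitions.RawMonoid as RawMonoidDefinitions
open import Data.Bool.Base using (if_then_else_)
open import Data.Empty using (⊥)
open import Data.Fin.Base using (Fin; splitAt)
open import Data.Fin.Subset using (Subset; _∈_; _∉_; _⊆_)
open import Data.Nat.Base as ℕ using (ℕ)
import Data.Nat.Properties as ℕ
open import Data.Product using (_×_; _,_; ∃-syntax)
open import Data.Rational as ℚ using (ℚ; 0ℚ; ½)
import Data.Rational.Properties as ℚ
open import Data.Rational.Solver using (module +-*-Solver)
open import Data.Sum.Base using (_⊎_; inj₁; inj₂)
open import Data.Vec.Base using (lookup)
open import Function.Bundles using (_⇔_)
open import Function.Definitions using (Injective)
open import Level using (0ℓ)
open import Relation.Binary.Construct.Closure.ReflexiveTransitive using (Star)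
open import Relation.Binary.PropositionalEquality using (_≡_; _≢_; refl; sym; trans; cong; subst; subst₂; ≢-sym)
open import Relation.Nullary using (¬_)

-- Real numbers: Cauchy sequences of rationals, with real equality being
-- the setoid equality _≈ᵣ_.
IsCauchy : (ℕ → ℚ) → Set
IsCauchy x = ∀ ε → 0ℚ ℚ.< ε →
  ∃[ N ] (∀ m n → N ℕ.≤ m → N ℕ.≤ n → ℚ.∣ x m ℚ.- x n ∣ ℚ.≤ ε)

record ℝ : Set where
  constructor mkℝ
  field
    seq    : ℕ → ℚ
    cauchy : IsCauchy seq

open ℝ public

infix  4 _≤ᵣ_ _≥ᵣ_ _≈ᵣ_
infixl 6 _+ᵣ_

-- The ε is needed: limits may be ordered although no tail of the
-- sequences is ordered termwise.
_≤ᵣ_ : ℝ → ℝ → Set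
x ≤ᵣ y = ∀ ε → 0ℚ ℚ.< ε →
  ∃[ N ] (∀ n → N ℕ.≤ n → seq x n ℚ.≤ seq y n ℚ.+ ε)

_≥ᵣ_ : ℝ → ℝ → Set
x ≥ᵣ y = y ≤ᵣ x

_≈ᵣ_ : ℝ → ℝ → Set
x ≈ᵣ y = x ≤ᵣ y × y ≤ᵣ x

0ᵣ : ℝ
0ᵣ = mkℝ (λ _ → 0ℚ) (λ ε 0<ε → 0 , λ _ _ _ _ → ℚ.<⇒≤ 0<ε)

private
  half-positive : ∀ ε → 0ℚ ℚ.< ε → 0ℚ ℚ.< ½ ℚ.* ε
  half-positive ε 0<ε =
    subst (ℚ._< ½ ℚ.* ε) (ℚ.*-zeroʳ ½) (ℚ.*-monoʳ-<-pos ½ 0<ε)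

  half+half : ∀ ε → ½ ℚ.* ε ℚ.+ ½ ℚ.* ε ≡ ε
  half+half ε = trans (sym (ℚ.*-distribʳ-+ ε ½ ½)) (ℚ.*-identityˡ ε)

  +-cauchy : ∀ x y → IsCauchy x → IsCauchy y → IsCauchy (λ n → x n ℚ.+ y n)
  +-cauchy x y cx cy ε 0<ε
    with cx (½ ℚ.* ε) (half-positive ε 0<ε) | cy (½ ℚ.* ε) (half-positive ε 0<ε)
  ... | M , p | N , q = M ℕ.⊔ N , λ m n M⊔N≤m M⊔N≤n →
    subst₂ ℚ._≤_
      (cong ℚ.∣_∣ (rearrange (x m) (x n) (y m) (y n)))
      (half+half ε)
      (ℚ.≤-trans (ℚ.∣p+q∣≤∣p∣+∣q∣ (x m ℚ.- x n) (y m ℚ.- y n))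
        (ℚ.+-mono-≤
          (p m n (ℕ.m⊔n≤o⇒m≤o M N M⊔N≤m) (ℕ.m⊔n≤o⇒m≤o M N M⊔N≤n))
          (q m n (ℕ.m⊔n≤o⇒n≤o M N M⊔N≤m) (ℕ.m⊔n≤o⇒n≤o M N M⊔N≤n))))
    where
    open +-*-Solver
    rearrange : ∀ a b c d →
      (a ℚ.- b) ℚ.+ (c ℚ.- d) ≡ (a ℚ.+ c) ℚ.- (b ℚ.+ d)
    rearrange = solve 4 (λ a b c d →
      (a :- b) :+ (c :- d) := (a :+ c) :- (b :+ d)) refl

_+ᵣ_ : ℝ → ℝ → ℝ
x +ᵣ y = mkℝ (λ n → seq x n ℚ.+ seq y n)
             (+-cauchy (seq x) (seq y) (cauchy x) (cauchy y))

+ᵣ-rawMonoid : RawMonoid 0ℓ 0ℓ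
+ᵣ-rawMonoid = record { Carrier = ℝ ; _≈_ = _≈ᵣ_ ; _∙_ = _+ᵣ_ ; ε = 0ᵣ }

open RawMonoidDefinitions +ᵣ-rawMonoid using (sum) public

weight : ∀ {n} → (Fin n → ℝ) → Subset n → ℝ
weight w X = sum (λ x → if lookup X x then w x else 0ᵣ)

-- The finite set V is Fin order; the set E is enumerated without
-- repetition by edge, so that Fin size stands for E.
record Hypergraph : Set where
  field
    order          : ℕ
    size           : ℕ
    edge           : Fin size → Subset order
    edge-injective : Injective _≡_ _≡_ edge

ContainsHyperedge : (H : Hypergraph) → Subset (Hypergraph.order H) → Set
ContainsHyperedge H X = ∃[ e ] Hypergraph.edge H e ⊆ X

Threshold : Hypergraph → Set
Threshold H =
  ∃[ w ] ∃[ t ]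
    (∀ v → 0ᵣ ≤ᵣ w v) ×
    0ᵣ ≤ᵣ t ×
    (∀ (X : Subset (Hypergraph.order H)) →
      weight w X ≤ᵣ t ⇔ (¬ ContainsHyperedge H X))

record Graph : Set₁ where
  field
    order      : ℕ
    Adj        : Fin order → Fin order → Set
    Adj-sym    : ∀ {u v} → Adj u v → Adj v u
    Adj-irrefl : ∀ {v} → ¬ Adj v v

module _ (G : Graph) where
  open Graph G

  Dominating : Subset order → Set
  Dominating S = ∀ v → v ∉ S → ∃[ u ] u ∈ S × Adj v u

  InducedAdj : Subset order → Fin order → Fin order → Set
  InducedAdj S u v = u ∈ S × v ∈ S × Adj u v

  -- The empty induced subgraph counts as connected.  Since the empty set
  -- dominates only the graph without vertices, this convention does not
  -- affect which graphs are connected-domishold.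
  InducedConnected : Subset order → Set
  InducedConnected S = ∀ {u v} → u ∈ S → v ∈ S → Star (InducedAdj S) u v

  ConnectedDominating : Subset order → Set
  ConnectedDominating S = Dominating S × InducedConnected S

  ConnectedDomishold : Set
  ConnectedDomishold =
    ∃[ w ] ∃[ t ]
      (∀ v → 0ᵣ ≤ᵣ w v) ×
      0ᵣ ≤ᵣ t ×
      (∀ (S : Subset order) → weight w S ≥ᵣ t ⇔ ConnectedDominating S)

module _ (H : Hypergraph) where
  open Hypergraph H

  SplitIncidenceAdj : Fin order ⊎ Fin size → Fin order ⊎ Fin size → Set
  SplitIncidenceAdj (inj₁ u) (inj₁ v) = u ≢ v
  SplitIncidenceAdj (inj₁ v) (inj₂ e) = v ∈ edge e
  SplitIncidenceAdj (inj₂ e) (inj₁ v) = v ∈ edge e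
  SplitIncidenceAdj (inj₂ _) (inj₂ _) = ⊥

  private
    adj-sym : ∀ x y → SplitIncidenceAdj x y → SplitIncidenceAdj y x
    adj-sym (inj₁ _) (inj₁ _) u≢v = ≢-sym u≢v
    adj-sym (inj₁ _) (inj₂ _) v∈e = v∈e
    adj-sym (inj₂ _) (inj₁ _) v∈e = v∈e

    adj-irrefl : ∀ x → ¬ SplitIncidenceAdj x x
    adj-irrefl (inj₁ _) v≢v = v≢v refl

  -- splitAt order identifies Fin (order + size) with V ⊎ E.
  splitIncidenceGraph : Graph
  splitIncidenceGraph = record
    { order      = order ℕ.+ size
    ; Adj        = λ x y → SplitIncidenceAdj (splitAt order x) (splitAt order y)
    ; Adj-sym    = λ {x} {y} → adj-sym (splitAt order x) (splitAt order y)
    ; Adj-irrefl = λ {x} → adj-irrefl (splitAt order x)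
    }

{-# OPTIONS --safe #-}

-- Every S ⊆ V ∪ E is X ∪ F with X ⊆ V and F ⊆ E.  If some hyperedge is not
-- all of V, then S is a connected dominating set exactly when X meets every
-- hyperedge, i.e. when V ∖ X contains no hyperedge: a hyperedge outside S
-- must be dominated by X, and a hyperedge inside S needs a neighbour in X to
-- be connected to anything else.  Giving hyperedges weight 0 and replacing t
-- by w(V) − t thus turns threshold weights into connected-domishold ones.  If
-- all hyperedges equal V, the split-incidence graph is complete and its
-- connected dominating sets are the nonempty ones.  Conversely, for F = ∅ and
-- E ≠ ∅ the same criterion holds without further assumption, so restricting
-- connected-domishold weights to V and complementing gives threshold weights.

module Submission where

open import Defs
open import Data.Bool.Base using (true; false; not; if_then_else_)
open import Data.Bool.Properties using (not-involutive)
open import Data.Fin.Base using (Fin; zero; suc; splitAt; join; _↑ˡ_; _↑ʳ_)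
import Data.Fin.Properties as Fin
open import Data.Fin.Subset using (Subset; ⊥; ⊤; ∁; _∈_; _∉_; Nonempty)
open import Data.Fin.Subset.Properties
  using (∈⊤; ⊆⊤; ⊆-antisym; ∉⊥; _∈?_; nonempty?; Empty-unique; x∈p⇒x∉∁p; x∉p⇒x∈∁p; x∈∁p⇒x∉p; x∉∁p⇒x∈p)
open import Data.Nat.Base as ℕ using (ℕ; zero; suc; _+_)
import Data.Nat.Properties as ℕ
open import Data.Product using (_×_; _,_; proj₁; proj₂; ∃-syntax)
open import Data.Rational as ℚ using (ℚ; 0ℚ; 1ℚ; ½; _≤_; _<_)
import Data.Rational.Properties as ℚ
open import Data.Rational.Solver using (module +-*-Solver)
open import Data.Sum.Base using (_⊎_; inj₁; inj₂; [_,_]′)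
import Data.Unit.Base as Unit
open import Data.Vec.Base as Vec using ([]; _∷_; _++_)
open import Data.Vec.Properties
  using ([]=⇒lookup; lookup⇒[]=; lookup-++ˡ; lookup-++ʳ; map-∘; map-cong; map-id)
open import Function.Base using (_∘_; id)
open import Function.Bundles using (_⇔_; mk⇔; module Equivalence)
open import Function.Construct.Composition using (_⇔-∘_)
open import Relation.Binary.Construct.Closure.ReflexiveTransitive
  using (Star; _◅_; _◅◅_; reverse) renaming (ε to refl⋆)
open import Relation.Binary.PropositionalEquality
  using (_≡_; _≢_; refl; sym; trans; cong; cong₂; subst; subst₂)
open import Relation.Nullary using (¬_; Dec; yes; no; contradiction; _×-dec_)
open import Relation.Nullary.Decidable using (from-no; decidable-stable)

open +-*-Solver using (solve; con; _:+_; _:-_; :-_; _:=_)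
open Equivalence using (to; from)

-- Real numbers

constᵣ : ℚ → ℝ
constᵣ q = mkℝ (λ _ → q) λ ε 0<ε → 0 , λ _ _ _ _ →
  subst (λ p → ℚ.∣ p ∣ ≤ ε) (sym (ℚ.+-inverseʳ q)) (ℚ.<⇒≤ 0<ε)

-ᵣ_ : ℝ → ℝ
-ᵣ x = mkℝ (λ n → ℚ.- seq x n) λ ε 0<ε →
  let N , p = cauchy x ε 0<ε in N , λ m n N≤m N≤n →
  subst (_≤ ε)
    (trans (sym (ℚ.∣-p∣≡∣p∣ (seq x m ℚ.- seq x n))) (cong ℚ.∣_∣ (ℚ.neg-distrib-+ (seq x m) (ℚ.- seq x n))))
    (p m n N≤m N≤n)

infixl 6 _-ᵣ_
_-ᵣ_ : ℝ → ℝ → ℝ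
x -ᵣ y = x +ᵣ (-ᵣ y)

p≤p+q : ∀ p {q} → 0ℚ ≤ q → p ≤ p ℚ.+ q
p≤p+q p {q} 0≤q = subst (_≤ p ℚ.+ q) (ℚ.+-identityʳ p) (ℚ.+-monoʳ-≤ p 0≤q)

≤-termwise : ∀ x y → (∀ n → seq x n ≤ seq y n) → x ≤ᵣ y
≤-termwise x y x≤y ε 0<ε = 0 , λ n _ → ℚ.≤-trans (x≤y n) (p≤p+q (seq y n) (ℚ.<⇒≤ 0<ε))

0ᵣ≤0ᵣ : 0ᵣ ≤ᵣ 0ᵣ
0ᵣ≤0ᵣ = ≤-termwise 0ᵣ 0ᵣ (λ _ → ℚ.≤-refl)

-- Adding `seq y′ n - seq y n` to both sides turns one approximate inequality into the other. All
-- inequalities between weights are transferred this way, from rational identities at each index.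
≤-resp-difference : ∀ x y x′ y′ →
  (∀ n → seq x′ n ℚ.- seq y′ n ≡ seq x n ℚ.- seq y n) → x ≤ᵣ y → x′ ≤ᵣ y′
≤-resp-difference x y x′ y′ same x≤y ε 0<ε =
  let N , p = x≤y ε 0<ε in N , λ n N≤n →
  subst₂ _≤_
    (trans (shift (seq x n) (seq y n) (seq y′ n))
      (trans (cong (ℚ._+ seq y′ n) (sym (same n))) (cancel (seq x′ n) (seq y′ n))))
    (move (seq y n) ε (seq y′ n))
    (ℚ.+-monoˡ-≤ (seq y′ n ℚ.- seq y n) (p n N≤n))
  where
  shift : ∀ a b c → a ℚ.+ (c ℚ.- b) ≡ (a ℚ.- b) ℚ.+ c
  shift = solve 3 (λ a b c → a :+ (c :- b) := (a :- b) :+ c) refl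
  cancel : ∀ a b → (a ℚ.- b) ℚ.+ b ≡ a
  cancel = solve 2 (λ a b → (a :- b) :+ b := a) refl
  move : ∀ b e c → (b ℚ.+ e) ℚ.+ (c ℚ.- b) ≡ c ℚ.+ e
  move = solve 3 (λ b e c → (b :+ e) :+ (c :- b) := c :+ e) refl

≤⇒0≤- : ∀ x y → x ≤ᵣ y → 0ᵣ ≤ᵣ y -ᵣ x
≤⇒0≤- x y = ≤-resp-difference x y 0ᵣ (y -ᵣ x) λ n → identity (seq x n) (seq y n)
  where
  identity : ∀ a b → 0ℚ ℚ.- (b ℚ.- a) ≡ a ℚ.- b
  identity a b = trans (ℚ.+-identityˡ _)
    (trans (ℚ.neg-distrib-+ b (ℚ.- a))
      (solve 2 (λ a b → (:- b) :+ (:- (:- a)) := a :- b) refl a b))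

∣p-q∣≤r⇒p≤q+r : ∀ p q r → ℚ.∣ p ℚ.- q ∣ ≤ r → p ≤ q ℚ.+ r
∣p-q∣≤r⇒p≤q+r p q r ∣p-q∣≤r =
  subst (_≤ q ℚ.+ r) (solve 2 (λ p q → q :+ (p :- q) := p) refl p q)
    (ℚ.+-monoʳ-≤ q (ℚ.≤-trans (p≤∣p∣ (p ℚ.- q)) ∣p-q∣≤r))
  where
  p≤∣p∣ : ∀ p → p ≤ ℚ.∣ p ∣
  p≤∣p∣ p with ℚ.≤-total 0ℚ p
  ... | inj₁ 0≤p = ℚ.≤-reflexive (sym (ℚ.0≤p⇒∣p∣≡p 0≤p))
  ... | inj₂ p≤0 = ℚ.≤-trans p≤0 (ℚ.0≤∣p∣ p)

halve : ∀ ε → 0ℚ < ε → ∃[ δ ] 0ℚ < δ × δ ℚ.+ δ ≡ ε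
halve ε 0<ε = ½ ℚ.* ε ,
  subst (_< ½ ℚ.* ε) (ℚ.*-zeroʳ ½) (ℚ.*-monoʳ-<-pos ½ 0<ε) ,
  trans (sym (ℚ.*-distribʳ-+ ε ½ ½)) (ℚ.*-identityˡ ε)

-- Constructively valid because y ≤ᵣ x need only be shown up to ε, and
-- comparing rational approximations of precision ε/2 either shows that or
-- gives x ≤ᵣ y.
≰ᵣ⇒≥ᵣ : ∀ x y → ¬ x ≤ᵣ y → x ≥ᵣ y
≰ᵣ⇒≥ᵣ x y x≰y ε 0<ε = N , bound
  where
  halves = halve ε 0<ε

  δ : ℚ
  δ = proj₁ halves

  z : ℕ → ℚ
  z = seq (x -ᵣ y)

  approximation = cauchy (x -ᵣ y) δ (proj₁ (proj₂ halves))

  N : ℕ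
  N = proj₁ approximation

  close : ∀ m n → N ℕ.≤ m → N ℕ.≤ n → ℚ.∣ z m ℚ.- z n ∣ ≤ δ
  close = proj₂ approximation

  0≤zN+δ : 0ℚ ≤ z N ℚ.+ δ
  0≤zN+δ with 0ℚ ℚ.≤? z N ℚ.+ δ
  ... | yes 0≤ = 0≤
  ... | no  0≰ = contradiction x≤y x≰y
    where
    x≤y : x ≤ᵣ y
    x≤y η 0<η = N , λ n N≤n → ℚ.≤-trans
      (subst₂ _≤_
        (solve 2 (λ a b → b :+ (a :- b) := a) refl (seq x n) (seq y n))
        (ℚ.+-identityʳ (seq y n))
        (ℚ.+-monoʳ-≤ (seq y n)
          (ℚ.≤-trans (∣p-q∣≤r⇒p≤q+r (z n) (z N) δ (close n N N≤n ℕ.≤-refl))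
            (ℚ.<⇒≤ (ℚ.≰⇒> 0≰)))))
      (p≤p+q (seq y n) (ℚ.<⇒≤ 0<η))

  bound : ∀ n → N ℕ.≤ n → seq y n ≤ seq x n ℚ.+ ε
  bound n N≤n = subst₂ _≤_
    (ℚ.+-identityʳ (seq y n))
    (trans
      (solve 3 (λ a b d → b :+ (((a :- b) :+ d) :+ d) := a :+ (d :+ d)) refl (seq x n) (seq y n) δ)
      (cong (seq x n ℚ.+_) (proj₂ (proj₂ halves))))
    (ℚ.+-monoʳ-≤ (seq y n)
      (ℚ.≤-trans 0≤zN+δ
        (ℚ.+-monoˡ-≤ δ (∣p-q∣≤r⇒p≤q+r (z N) (z n) δ (close N n ℕ.≤-refl N≤n)))))

∁-involutive : ∀ {n} (X : Subset n) → ∁ (∁ X) ≡ X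
∁-involutive X = trans (sym (map-∘ not not X)) (trans (map-cong not-involutive X) (map-id X))

-- Weights

-- Stated at each index `k`, where the identity is an exact equality of rationals and can feed
-- `≤-resp-difference`.
weight-++ : ∀ {n m} (w : Fin (n + m) → ℝ) (X : Subset n) (F : Subset m) k →
  seq (weight w (X ++ F)) k ≡ seq (weight (w ∘ (_↑ˡ m)) X) k ℚ.+ seq (weight (w ∘ (n ↑ʳ_)) F) k
weight-++ w []      F k = sym (ℚ.+-identityˡ _)
weight-++ {suc n} {m} w (b ∷ X) F k = trans
  (cong (seq head k ℚ.+_) (weight-++ (w ∘ suc) X F k))
  (sym (ℚ.+-assoc (seq head k) (seq (weight (w ∘ suc ∘ (_↑ˡ m)) X) k) (seq (weight (w ∘ suc ∘ (n ↑ʳ_)) F) k)))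
  where
  head : ℝ
  head = if b then w zero else 0ᵣ

weight-cong : ∀ {n} (w w′ : Fin n → ℝ) k → (∀ i → seq (w i) k ≡ seq (w′ i) k) →
  ∀ X → seq (weight w X) k ≡ seq (weight w′ X) k
weight-cong w w′ k eq []          = refl
weight-cong w w′ k eq (true  ∷ X) = cong₂ ℚ._+_ (eq zero) (weight-cong (w ∘ suc) (w′ ∘ suc) k (eq ∘ suc) X)
weight-cong w w′ k eq (false ∷ X) = cong (0ℚ ℚ.+_) (weight-cong (w ∘ suc) (w′ ∘ suc) k (eq ∘ suc) X)

weight-∁ : ∀ {n} (w : Fin n → ℝ) X k →
  seq (weight w X) k ℚ.+ seq (weight w (∁ X)) k ≡ seq (weight w ⊤) k
weight-∁ w []          k = refl
weight-∁ w (true  ∷ X) k = trans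
  (solve 3 (λ a s s′ → (a :+ s) :+ (con 0ℚ :+ s′) := a :+ (s :+ s′)) refl
    (seq (w zero) k) (seq (weight (w ∘ suc) X) k) (seq (weight (w ∘ suc) (∁ X)) k))
  (cong (seq (w zero) k ℚ.+_) (weight-∁ (w ∘ suc) X k))
weight-∁ w (false ∷ X) k = trans
  (solve 3 (λ a s s′ → (con 0ℚ :+ s) :+ (a :+ s′) := a :+ (s :+ s′)) refl
    (seq (w zero) k) (seq (weight (w ∘ suc) X) k) (seq (weight (w ∘ suc) (∁ X)) k))
  (cong (seq (w zero) k ℚ.+_) (weight-∁ (w ∘ suc) X k))

weight-zero : ∀ {n} (w : Fin n → ℝ) k → (∀ i → seq (w i) k ≡ 0ℚ) → ∀ X → seq (weight w X) k ≡ 0ℚ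
weight-zero w k eq []          = refl
weight-zero w k eq (true  ∷ X) = cong₂ ℚ._+_ (eq zero) (weight-zero (w ∘ suc) k (eq ∘ suc) X)
weight-zero w k eq (false ∷ X) = cong (0ℚ ℚ.+_) (weight-zero (w ∘ suc) k (eq ∘ suc) X)

weight-⊥ : ∀ {n} (w : Fin n → ℝ) k → seq (weight w ⊥) k ≡ 0ℚ
weight-⊥ {zero}  w k = refl
weight-⊥ {suc n} w k = cong (0ℚ ℚ.+_) (weight-⊥ (w ∘ suc) k)

-- A real that is nonnegative for `_≤ᵣ_` may have negative terms, so nonnegativity is assumed at the
-- index `k`; the constant weights 1 satisfy it.
weight-nonneg : ∀ {n} (w : Fin n → ℝ) k → (∀ i → 0ℚ ≤ seq (w i) k) → ∀ X → 0ℚ ≤ seq (weight w X) k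
weight-nonneg w k 0≤w []          = ℚ.≤-refl
weight-nonneg w k 0≤w (true  ∷ X) = ℚ.+-mono-≤ (0≤w zero) (weight-nonneg (w ∘ suc) k (0≤w ∘ suc) X)
weight-nonneg w k 0≤w (false ∷ X) = ℚ.+-mono-≤ (ℚ.≤-refl {0ℚ}) (weight-nonneg (w ∘ suc) k (0≤w ∘ suc) X)

weight-∈ : ∀ {n} (w : Fin n → ℝ) k → (∀ i → 0ℚ ≤ seq (w i) k) →
  ∀ X {i} → i ∈ X → seq (w i) k ≤ seq (weight w X) k
weight-∈ w k 0≤w (_ ∷ X) Vec.here =
  p≤p+q (seq (w zero) k) (weight-nonneg (w ∘ suc) k (0≤w ∘ suc) X)
weight-∈ w k 0≤w (b ∷ X) {suc i} (Vec.there i∈X) =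
  subst (_≤ seq (weight w (b ∷ X)) k) (ℚ.+-identityˡ (seq (w (suc i)) k))
    (ℚ.+-mono-≤ (head-nonneg b) (weight-∈ (w ∘ suc) k (0≤w ∘ suc) X i∈X))
  where
  head-nonneg : ∀ b → 0ℚ ≤ seq (if b then w zero else 0ᵣ) k
  head-nonneg true  = 0≤w zero
  head-nonneg false = ℚ.≤-refl

-- Complete graphs

Complete : Graph → Set
Complete G = ∀ {u v} → u ≢ v → Graph.Adj G u v

module _ (G : Graph) (complete : Complete G) where
  open Graph G

  -- The vertex `v` rules out the empty graph, which the empty set dominates: either `v` lies in `S`
  -- or its dominator does.
  nonempty⇔connectedDominating : Fin order → ∀ S → Nonempty S ⇔ ConnectedDominating G S
  nonempty⇔connectedDominating v S = mk⇔ nonempty⇒ ⇒nonempty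
    where
    nonempty⇒ : Nonempty S → ConnectedDominating G S
    nonempty⇒ (s , s∈S) =
      (λ u u∉S → s , s∈S , complete λ u≡s → u∉S (subst (_∈ S) (sym u≡s) s∈S)) , connect
      where
      connect : InducedConnected G S
      connect {a} {b} a∈S b∈S with a Fin.≟ b
      ... | yes refl = refl⋆
      ... | no  a≢b  = (a∈S , b∈S , complete a≢b) ◅ refl⋆

    ⇒nonempty : ConnectedDominating G S → Nonempty S
    ⇒nonempty (dominating , _) with v ∈? S
    ... | yes v∈S = v , v∈S
    ... | no  v∉S = let u , u∈S , _ = dominating v v∉S in u , u∈S

zero≱1 : ∀ x → (∀ k → seq x k ≡ 0ℚ) → ¬ x ≥ᵣ constᵣ 1ℚ
zero≱1 x x≡0 x≥1 =
  let N , p = x≥1 ½ (ℚ.positive⁻¹ ½) in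
  from-no (1ℚ ℚ.≤? 0ℚ ℚ.+ ½) (subst (λ q → 1ℚ ≤ q ℚ.+ ½) (x≡0 N) (p N ℕ.≤-refl))

weight-const-1 : ∀ {n} (S : Subset n) → weight (λ _ → constᵣ 1ℚ) S ≥ᵣ constᵣ 1ℚ ⇔ Nonempty S
weight-const-1 {n} S = mk⇔ ⇒nonempty nonempty⇒
  where
  ones : Fin n → ℝ
  ones _ = constᵣ 1ℚ

  0≤1 : 0ℚ ≤ 1ℚ
  0≤1 = ℚ.nonNegative⁻¹ 1ℚ

  nonempty⇒ : Nonempty S → weight ones S ≥ᵣ constᵣ 1ℚ
  nonempty⇒ (_ , s∈S) =
    ≤-termwise (constᵣ 1ℚ) (weight ones S) λ k → weight-∈ ones k (λ _ → 0≤1) S s∈S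

  ⇒nonempty : weight ones S ≥ᵣ constᵣ 1ℚ → Nonempty S
  ⇒nonempty heavy = decidable-stable (nonempty? S) λ empty →
    zero≱1 (weight ones S)
      (λ k → subst (λ X → seq (weight ones X) k ≡ 0ℚ) (sym (Empty-unique empty)) (weight-⊥ ones k))
      heavy

complete⇒connectedDomishold : ∀ G → Complete G → ConnectedDomishold G
complete⇒connectedDomishold record { order = zero } _ =
  -- Without vertices the empty set is connected dominating and has weight 0, so the threshold 1 of
  -- the other case would fail.
  (λ _ → 0ᵣ) , 0ᵣ , (λ ()) , 0ᵣ≤0ᵣ ,
  λ { [] → mk⇔ (λ _ → (λ ()) , λ {}) λ _ → 0ᵣ≤0ᵣ }
complete⇒connectedDomishold G@record { order = suc _ } complete =
  (λ _ → constᵣ 1ℚ) , constᵣ 1ℚ , (λ _ → 0≤ᵣ1) , 0≤ᵣ1 ,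
  λ S → nonempty⇔connectedDominating G complete zero S ⇔-∘ weight-const-1 S
  where
  0≤ᵣ1 : 0ᵣ ≤ᵣ constᵣ 1ℚ
  0≤ᵣ1 = ≤-termwise 0ᵣ (constᵣ 1ℚ) λ _ → ℚ.nonNegative⁻¹ 1ℚ

-- Split-incidence graphs

module _ (H : Hypergraph) where
  open Hypergraph H

  private
    G : Graph
    G = splitIncidenceGraph H

    Node : Set
    Node = Fin order ⊎ Fin size

    node : Node → Fin (order + size)
    node = join order size

  open Graph G using (Adj; Adj-sym)

  -- Matching on this view rewrites an index to the form `node a`, to which `adj⁺` and `adj⁻` apply.
  data NodeView : Fin (order + size) → Set where
    ⟨_⟩ : ∀ a → NodeView (node a)

  nodeView : ∀ x → NodeView x
  nodeView x = subst NodeView (Fin.join-splitAt order size x) ⟨ splitAt order x ⟩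

  Adj-node : ∀ a b → Adj (node a) (node b) ≡ SplitIncidenceAdj H a b
  Adj-node a b = cong₂ (SplitIncidenceAdj H) (Fin.splitAt-join order size a) (Fin.splitAt-join order size b)

  adj⁺ : ∀ a b → SplitIncidenceAdj H a b → Adj (node a) (node b)
  adj⁺ a b = subst id (sym (Adj-node a b))

  adj⁻ : ∀ a b → Adj (node a) (node b) → SplitIncidenceAdj H a b
  adj⁻ a b = subst id (Adj-node a b)

  -- Transversals and connected dominating sets

  Transversal : Subset order → Set
  Transversal X = ∀ e → ∃[ v ] v ∈ edge e × v ∈ X

  -- A hyperedge misses `X` exactly when it lies in `∁ X`. Finite search for a common vertex makes
  -- the converse constructive.
  transversal⇔∁-independent : ∀ X → Transversal X ⇔ (¬ ContainsHyperedge H (∁ X))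
  transversal⇔∁-independent X = mk⇔ transversal⇒ ⇒transversal
    where
    transversal⇒ : Transversal X → ¬ ContainsHyperedge H (∁ X)
    transversal⇒ meets (e , e⊆∁X) = let _ , v∈e , v∈X = meets e in x∈p⇒x∉∁p v∈X (e⊆∁X v∈e)

    ⇒transversal : ¬ ContainsHyperedge H (∁ X) → Transversal X
    ⇒transversal independent e = decidable-stable (Fin.any? λ v → (v ∈? edge e) ×-dec (v ∈? X))
      λ misses → independent (e , λ {v} v∈e → x∉p⇒x∈∁p λ v∈X → misses (v , v∈e , v∈X))

  module _ (X : Subset order) (F : Subset size) where

    vertex∈⁺ : ∀ {v} → v ∈ X → node (inj₁ v) ∈ X ++ F
    vertex∈⁺ {v} v∈X = lookup⇒[]= _ (X ++ F) (trans (lookup-++ˡ X F v) ([]=⇒lookup v∈X))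

    vertex∈⁻ : ∀ {v} → node (inj₁ v) ∈ X ++ F → v ∈ X
    vertex∈⁻ {v} v∈S = lookup⇒[]= v X (trans (sym (lookup-++ˡ X F v)) ([]=⇒lookup v∈S))

    hyperedge∈⁻ : ∀ {e} → node (inj₂ e) ∈ X ++ F → e ∈ F
    hyperedge∈⁻ {e} e∈S = lookup⇒[]= e F (trans (sym (lookup-++ʳ X F e)) ([]=⇒lookup e∈S))

    -- Hyperedges are pairwise nonadjacent, so `y` has to be a vertex.
    hyperedge-neighbour : ∀ e {y} → Adj (node (inj₂ e)) y → y ∈ X ++ F → ∃[ v ] v ∈ edge e × v ∈ X
    hyperedge-neighbour e {y} adj y∈S with nodeView y
    ... | ⟨ inj₁ v ⟩ = v , adj⁻ (inj₂ e) (inj₁ v) adj , vertex∈⁻ y∈S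
    ... | ⟨ inj₂ f ⟩ with () ← adj⁻ (inj₂ e) (inj₂ f) adj

    hyperedge∉⇒meets : Dominating G (X ++ F) → ∀ e → node (inj₂ e) ∉ X ++ F → ∃[ v ] v ∈ edge e × v ∈ X
    hyperedge∉⇒meets dominating e e∉S =
      let _ , u∈S , adj = dominating (node (inj₂ e)) e∉S in hyperedge-neighbour e adj u∈S

    -- A path to a different node has a first step, which leads from `e` to a vertex of `X`.
    path⇒meets : ∀ {e y} → node (inj₂ e) ≢ y → Star (InducedAdj G (X ++ F)) (node (inj₂ e)) y →
      ∃[ v ] v ∈ edge e × v ∈ X
    path⇒meets e≢y refl⋆                 = contradiction refl e≢y
    path⇒meets e≢y ((_ , z∈S , adj) ◅ _) = hyperedge-neighbour _ adj z∈S

    -- The hyperedge `e₀` yields a vertex `hub` of `X`. It dominates the clique V, and every node of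
    -- the set reaches it in at most two steps.
    transversal⇒connectedDominating : Fin size → Transversal X → ConnectedDominating G (X ++ F)
    transversal⇒connectedDominating e₀ meets = dominating , connected
      where
      hub : Fin order
      hub = proj₁ (meets e₀)

      hub∈X : hub ∈ X
      hub∈X = proj₂ (proj₂ (meets e₀))

      dominating : Dominating G (X ++ F)
      dominating y y∉S with nodeView y
      ... | ⟨ inj₁ v ⟩ = node (inj₁ hub) , vertex∈⁺ hub∈X ,
        adj⁺ (inj₁ v) (inj₁ hub) λ v≡hub → y∉S (vertex∈⁺ (subst (_∈ X) (sym v≡hub) hub∈X))
      ... | ⟨ inj₂ e ⟩ = let v , v∈e , v∈X = meets e in
        node (inj₁ v) , vertex∈⁺ v∈X , adj⁺ (inj₂ e) (inj₁ v) v∈e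

      vertex-to-hub : ∀ {v} → v ∈ X → Star (InducedAdj G (X ++ F)) (node (inj₁ v)) (node (inj₁ hub))
      vertex-to-hub {v} v∈X with v Fin.≟ hub
      ... | yes refl  = refl⋆
      ... | no  v≢hub = (vertex∈⁺ v∈X , vertex∈⁺ hub∈X , adj⁺ (inj₁ v) (inj₁ hub) v≢hub) ◅ refl⋆

      to-hub : ∀ {y} → y ∈ X ++ F → Star (InducedAdj G (X ++ F)) y (node (inj₁ hub))
      to-hub {y} y∈S with nodeView y
      ... | ⟨ inj₁ v ⟩ = vertex-to-hub (vertex∈⁻ y∈S)
      ... | ⟨ inj₂ e ⟩ = let v , v∈e , v∈X = meets e in
        (y∈S , vertex∈⁺ v∈X , adj⁺ (inj₂ e) (inj₁ v) v∈e) ◅ vertex-to-hub v∈X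

      connected : InducedConnected G (X ++ F)
      connected u∈S v∈S =
        to-hub u∈S ◅◅ reverse (λ { {x} {y} (x∈S , y∈S , adj) → y∈S , x∈S , Adj-sym {x} {y} adj }) (to-hub v∈S)

    -- A hyperedge inside the set is joined by a path to any vertex of `X`, so it suffices that `X`
    -- be nonempty. The non-incident pair `v₀`, `e₀` ensures this: it excludes a set consisting of a
    -- single hyperedge.
    connectedDominating⇒transversal : ∀ {e₀ v₀} → v₀ ∉ edge e₀ →
      ConnectedDominating G (X ++ F) → Transversal X
    connectedDominating⇒transversal {e₀} {v₀} v₀∉e₀ (dominating , connected) e
      with node (inj₂ e) ∈? (X ++ F)
    ... | no  e∉S = hyperedge∉⇒meets dominating e e∉S
    ... | yes e∈S = path⇒meets (λ eq → vertex≢hyperedge (sym eq)) (connected e∈S (vertex∈⁺ (proj₂ nonempty)))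
      where
      vertex≢hyperedge : ∀ {v f} → node (inj₁ v) ≢ node (inj₂ f)
      vertex≢hyperedge {v} {f} eq
        with () ← trans (sym (Fin.splitAt-join order size (inj₁ v)))
                    (trans (cong (splitAt order) eq) (Fin.splitAt-join order size (inj₂ f)))

      -- Here `v₀` is dominated by a hyperedge `f`, which differs from `e₀` because it contains
      -- `v₀`. So `e₀` is either dominated from `X` or joined to `f` by a path through `X`.
      e₀-meets-via : ∀ f → v₀ ∈ edge f → node (inj₂ f) ∈ X ++ F → ∃[ v ] v ∈ edge e₀ × v ∈ X
      e₀-meets-via f v₀∈f f∈S with node (inj₂ e₀) ∈? (X ++ F)
      ... | no  e₀∉S = hyperedge∉⇒meets dominating e₀ e₀∉S
      ... | yes e₀∈S = path⇒meets
        (λ eq → v₀∉e₀ (subst (λ g → v₀ ∈ edge g) (sym (Fin.↑ʳ-injective order e₀ f eq)) v₀∈f))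
        (connected e₀∈S f∈S)

      nonempty : Nonempty X
      nonempty with node (inj₁ v₀) ∈? (X ++ F)
      ... | yes v₀∈S = v₀ , vertex∈⁻ v₀∈S
      ... | no  v₀∉S with dominating (node (inj₁ v₀)) v₀∉S
      ...   | u , u∈S , adj with nodeView u
      ...     | ⟨ inj₁ v ⟩ = v , vertex∈⁻ u∈S
      ...     | ⟨ inj₂ f ⟩ =
        let v , _ , v∈X = e₀-meets-via f (adj⁻ (inj₁ v₀) (inj₂ f) adj) u∈S in v , v∈X

  -- Every hyperedge lies outside the set, hence is dominated by a vertex of `X`.
  connectedDominating-⊥⇒transversal : ∀ X → ConnectedDominating G (X ++ ⊥) → Transversal X
  connectedDominating-⊥⇒transversal X (dominating , _) e =
    hyperedge∉⇒meets X ⊥ dominating e (∉⊥ ∘ hyperedge∈⁻ X ⊥)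

  -- By `edge-injective` there is at most one hyperedge, so no two distinct nodes are nonadjacent.
  full-edges⇒complete : (∀ e → edge e ≡ ⊤) → Complete G
  full-edges⇒complete full {x} {y} x≢y with nodeView x | nodeView y
  ... | ⟨ inj₁ u ⟩ | ⟨ inj₁ v ⟩ = adj⁺ (inj₁ u) (inj₁ v) (x≢y ∘ cong (node ∘ inj₁))
  ... | ⟨ inj₁ v ⟩ | ⟨ inj₂ e ⟩ = adj⁺ (inj₁ v) (inj₂ e) (subst (v ∈_) (sym (full e)) ∈⊤)
  ... | ⟨ inj₂ e ⟩ | ⟨ inj₁ v ⟩ = adj⁺ (inj₂ e) (inj₁ v) (subst (v ∈_) (sym (full e)) ∈⊤)
  ... | ⟨ inj₂ e ⟩ | ⟨ inj₂ f ⟩ =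
    contradiction (cong (node ∘ inj₂) (edge-injective (trans (full e) (sym (full f))))) x≢y

  -- Transfer of weights

  threshold⇒connectedDomishold : ∀ {e₀ v₀} → v₀ ∉ edge e₀ → Threshold H → ConnectedDomishold G
  threshold⇒connectedDomishold {e₀} {v₀} v₀∉e₀ (w , t , 0≤w , _ , separates) =
    W , T , 0≤W , 0≤T , correct
    where
    W′ : Node → ℝ
    W′ = [ w , (λ _ → 0ᵣ) ]′

    0≤W′ : ∀ a → 0ᵣ ≤ᵣ W′ a
    0≤W′ (inj₁ v) = 0≤w v
    0≤W′ (inj₂ _) = 0ᵣ≤0ᵣ

    W : Fin (order + size) → ℝ
    W = W′ ∘ splitAt order

    T : ℝ
    T = weight w ⊤ -ᵣ t

    0≤W : ∀ x → 0ᵣ ≤ᵣ W x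
    0≤W x = 0≤W′ (splitAt order x)

    -- V contains `e₀`, so w(V) ≤ t fails, and therefore t ≤ w(V).
    0≤T : 0ᵣ ≤ᵣ T
    0≤T = ≤⇒0≤- t (weight w ⊤) (≰ᵣ⇒≥ᵣ (weight w ⊤) t λ light →
      to (separates ⊤) light (e₀ , λ _ → ∈⊤))

    weight-W : ∀ X F k → seq (weight W (X ++ F)) k ≡ seq (weight w X) k
    weight-W X F k = trans (weight-++ W X F k)
      (trans
        (cong₂ ℚ._+_
          (weight-cong (λ v → W (node (inj₁ v))) w k
            (λ v → cong (λ a → seq (W′ a) k) (Fin.splitAt-join order size (inj₁ v))) X)
          (weight-zero (λ e → W (node (inj₂ e))) k
            (λ e → cong (λ a → seq (W′ a) k) (Fin.splitAt-join order size (inj₂ e))) F))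
        (ℚ.+-identityʳ _))

    -- (w(V) - t) - w(X) = w(V ∖ X) - t, so reaching `T` means that the complement of `X` stays
    -- within `t`.
    difference : ∀ X F k →
      seq T k ℚ.- seq (weight W (X ++ F)) k ≡ seq (weight w (∁ X)) k ℚ.- seq t k
    difference X F k = trans
      (cong₂ (λ a b → (a ℚ.- seq t k) ℚ.- b) (sym (weight-∁ w X k)) (weight-W X F k))
      (solve 3 (λ a b c → ((a :+ b) :- c) :- a := b :- c) refl
        (seq (weight w X) k) (seq (weight w (∁ X)) k) (seq t k))

    correct′ : ∀ X F → weight W (X ++ F) ≥ᵣ T ⇔ ConnectedDominating G (X ++ F)
    correct′ X F = mk⇔
      (λ heavy → transversal⇒connectedDominating X F e₀ (from (transversal⇔∁-independent X)
        (to (separates (∁ X)) (≤-resp-difference T (weight W (X ++ F)) (weight w (∁ X)) t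
          (λ k → sym (difference X F k)) heavy))))
      λ cds → ≤-resp-difference (weight w (∁ X)) t T (weight W (X ++ F)) (difference X F)
        (from (separates (∁ X)) (to (transversal⇔∁-independent X)
          (connectedDominating⇒transversal X F v₀∉e₀ cds)))

    correct : ∀ S → weight W S ≥ᵣ T ⇔ ConnectedDominating G S
    correct S = let X , F , S≡X++F = Vec.splitAt order S in
      subst (λ S → weight W S ≥ᵣ T ⇔ ConnectedDominating G S) (sym S≡X++F) (correct′ X F)

  connectedDomishold⇒threshold : Fin size → (∀ e → edge e ≢ ⊥) → ConnectedDomishold G → Threshold H
  connectedDomishold⇒threshold e₀ edge≢⊥ (W , T , 0≤W , _ , separates) =
    w , t , (λ v → 0≤W (node (inj₁ v))) , 0≤t , correct
    where
    w : Fin order → ℝ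
    w v = W (node (inj₁ v))

    t : ℝ
    t = weight w ⊤ -ᵣ T

    weight-w : ∀ X k → seq (weight W (X ++ ⊥)) k ≡ seq (weight w X) k
    weight-w X k = trans (weight-++ W X ⊥ k)
      (trans (cong (seq (weight w X) k ℚ.+_) (weight-⊥ (λ e → W (node (inj₂ e))) k)) (ℚ.+-identityʳ _))

    heavy⇔transversal : ∀ X → weight W (X ++ ⊥) ≥ᵣ T ⇔ Transversal X
    heavy⇔transversal X = mk⇔
      (connectedDominating-⊥⇒transversal X ∘ to (separates (X ++ ⊥)))
      (from (separates (X ++ ⊥)) ∘ transversal⇒connectedDominating X ⊥ e₀)

    -- Since hyperedges are nonempty, V is a transversal and so reaches `T`; this gives `0≤t`.
    ⊤-transversal : Transversal ⊤
    ⊤-transversal e =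
      let v , v∈e = decidable-stable (nonempty? (edge e)) (edge≢⊥ e ∘ Empty-unique)
      in v , v∈e , ∈⊤

    0≤t : 0ᵣ ≤ᵣ t
    0≤t = ≤⇒0≤- T (weight w ⊤)
      (≤-resp-difference T (weight W (⊤ {order} ++ ⊥ {size})) T (weight w ⊤)
        (λ k → cong (λ a → seq T k ℚ.- a) (sym (weight-w ⊤ k)))
        (from (heavy⇔transversal ⊤) ⊤-transversal))

    difference : ∀ Y k →
      seq (weight w Y) k ℚ.- seq t k ≡ seq T k ℚ.- seq (weight W (∁ Y ++ ⊥)) k
    difference Y k = trans
      (cong (λ a → seq (weight w Y) k ℚ.- (a ℚ.- seq T k)) (sym (weight-∁ w Y k)))
      (trans
        (solve 3 (λ a b c → a :- ((a :+ b) :- c) := c :- b) refl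
          (seq (weight w Y) k) (seq (weight w (∁ Y)) k) (seq T k))
        (cong (λ a → seq T k ℚ.- a) (sym (weight-w (∁ Y) k))))

    correct : ∀ Y → weight w Y ≤ᵣ t ⇔ (¬ ContainsHyperedge H Y)
    correct Y = mk⇔
      (λ light → subst (λ Z → ¬ ContainsHyperedge H Z) (∁-involutive Y)
        (to (transversal⇔∁-independent (∁ Y)) (to (heavy⇔transversal (∁ Y))
          (≤-resp-difference (weight w Y) t T (weight W (∁ Y ++ ⊥)) (λ k → sym (difference Y k)) light))))
      λ independent → ≤-resp-difference T (weight W (∁ Y ++ ⊥)) (weight w Y) t (difference Y)
        (from (heavy⇔transversal (∁ Y)) (from (transversal⇔∁-independent (∁ Y))
          (subst (λ Z → ¬ ContainsHyperedge H Z) (sym (∁-involutive Y)) independent)))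

  -- Without hyperedges the empty set is a transversal but does not dominate a nonempty V, so
  -- weights are given directly instead of by restriction.
  edgeless⇒threshold : ¬ Fin size → Threshold H
  edgeless⇒threshold edgeless =
    (λ _ → 0ᵣ) , 0ᵣ , (λ _ → 0ᵣ≤0ᵣ) , 0ᵣ≤0ᵣ ,
    λ X → mk⇔ (λ _ (e , _) → edgeless e) λ _ →
      ≤-termwise (weight (λ _ → 0ᵣ) X) 0ᵣ λ k → ℚ.≤-reflexive (weight-zero (λ _ → 0ᵣ) k (λ _ → refl) X)

mainTheorem6 : (H : Hypergraph) → (∀ e → Hypergraph.edge H e ≢ ⊥) →
    Threshold H ⇔ ConnectedDomishold (splitIncidenceGraph H)
mainTheorem6 H edge≢⊥ =
  -- The search with the trivial predicate decides whether there is a hyperedge at all.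
  mk⇔ (forward (Fin.any? λ e → nonempty? (∁ (edge e)))) (backward (Fin.any? λ _ → yes Unit.tt))
  where
  open Hypergraph H

  forward : Dec (∃[ e ] Nonempty (∁ (edge e))) → Threshold H → ConnectedDomishold (splitIncidenceGraph H)
  forward (yes (e , v , v∈∁e)) threshold = threshold⇒connectedDomishold H (x∈∁p⇒x∉p v∈∁e) threshold
  -- This case includes hypergraphs without hyperedges.
  forward (no all-full)        _         = complete⇒connectedDomishold (splitIncidenceGraph H)
    (full-edges⇒complete H λ e → ⊆-antisym ⊆⊤ λ {v} _ → x∉∁p⇒x∈p λ v∈∁e → all-full (e , v , v∈∁e))

  backward : Dec (Fin size × Unit.⊤) → ConnectedDomishold (splitIncidenceGraph H) → Threshold H
  backward (yes (e , _))  domishold = connectedDomishold⇒threshold H e edge≢⊥ domishold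
  backward (no  edgeless) _         = edgeless⇒threshold H λ e → edgeless (e , Unit.tt)
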